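{- Let $k=\mathbb F_q$ and let $E/k$ be an elliptic curve with a faithful action of a finite group $\Lambda$ on $E_{\bar k}$ by curve automorphisms that is stable under $q$-power Frobenius conjugation and whose group of linear parts is nontrivial. Let $\pi:E\to Y:=E/\Lambda$ be the quotient (defined over $k$), $\mathcal F_E$ the $q$-power Frobenius, and for $\gamma\in\Lambda$ put $$\mathcal S_\gamma(E)=\{P\in E(\bar k):\mathcal F_E(P)=\gamma_E(P)\}.$$ Let $Q\in Y(k)$, choose $P\in\pi^{ -1}(Q)$, write $\Lambda_P=\operatorname{Stab}_\Lambda(P)$, and for $\gamma\in\Lambda$ put $m_Q(\gamma)=\lvert\mathcal S_\gamma(E)\cap\pi^{ -1}(Q)\rvert$. Then every point of the geometric fibre $\pi^{ -1}(Q)$ lies in exactly $\lvert\Lambda_P\rvert$ of the sets $\mathcal S_\gamma(E)$, $\gamma\in\Lambda$. Consequently, $$\sum_{\gamma\in\Lambda}m_Q(\gamma)=\lvert\Lambda\rvert .$$ The function $\gamma\mapsto m_Q(\gamma)$ is constant on every $\sim_\vartheta$-class. Thus, for any complete set $\mathcal R$ of representatives for the $\sim_\vartheta$-classes in $\Lambda$, $$\sum_{\gamma\in\mathcal R}\lvert[\gamma]_\vartheta\rvert\,m_Q(\gamma)=\lvert\Lambda\rvert .$$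
   Context: $\bar k$ is an algebraic closure of $k$. Every curve automorphism $\gamma_E$ of $E_{\bar k}$ is uniquely $\gamma_E(P)=u_{\gamma,E}(P)+a_{\gamma,E}$ with $u_{\gamma,E}\in\operatorname{Aut}_{\bar k}(E,\mathrm O_E)$, the linear part. The action is stable under $q$-power Frobenius conjugation if the image of $\Lambda$ in $\operatorname{Aut}_{\bar k}(E)$ is invariant under conjugation by the bijection $\mathcal F_E$ of $E(\bar k)$; then there is a unique $\vartheta\in\operatorname{Aut}(\Lambda)$ with $\vartheta(\gamma)_E=\mathcal F_E\circ\gamma_E\circ\mathcal F_E^{ -1}$ on $E(\bar k)$ for all $\gamma\in\Lambda$. The equivalence relation $\sim_\vartheta$ on $\Lambda$ is: $\gamma\sim_\vartheta\eta$ iff $\eta=\vartheta(h)\gamma h^{ -1}$ for some $h\in\Lambda$; $[\gamma]_\vartheta$ is the class of $\gamma$. The quotient $Y$ and $\pi$ descend to $k$, and geometric fibres of $\pi$ are single $\Lambda$-orbits. -}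

module Defs where

open import Algebra.Bundles using (CommutativeRing; Group)
open import Algebra.Morphism.Structures using (IsRingHomomorphism; module RingMorphisms)
open import Data.Fin.Base as Fin using (Fin; zero; suc; toℕ)
import Data.Fin.Properties as Fin
open import Data.Fin.Permutation using (Permutation; permutation)
open import Data.Fin.Patterns using (0F; 1F; 2F)
open import Data.List.Base as List using (List; []; _∷_)
open import Data.List.Relation.Unary.All as All using (All; []; _∷_)
open import Data.Maybe.Base using (Maybe; just; nothing)
open import Data.Maybe.Relation.Binary.Pointwise as Maybe using ()
open import Data.Nat.Base as ℕ using (ℕ; zero; suc; NonZero; _<_; _≤_; _!)
import Data.Nat.Properties as ℕ
open import Data.Nat.Combinatorics using (_C_; nCn≡1; nCk≡n!/k![n-k]!; k![n∸k]!∣n!)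
open import Data.Nat.Divisibility using (_∣_; divides; m∣m*n; ∣⇒≤)
open import Data.Nat.DivMod using (m/n*n≡m)
open import Data.Nat.Primality using (Prime; euclidsLemma; prime⇒nonZero; prime⇒nonTrivial)
open import Data.Product using (Σ; ∃; ∃!; _×_; _,_; proj₁; proj₂)
open import Data.Product.Relation.Binary.Pointwise.NonDependent as Product using ()
open import Data.Sum.Base using (_⊎_; inj₁; inj₂)
import Data.Vec.Functional as Vector
open Vector using (Vector)
open import Function.Base using (_∘_; id)
open import Function.Bundles using (Inverse; Func)
open import Level using (Level; _⊔_) renaming (suc to lsuc)
open import Relation.Binary.Bundles using (Setoid)
open import Relation.Binary.Definitions using (Decidable)
import Relation.Binary.Construct.On as On
open import Relation.Binary.PropositionalEquality as ≡ using (_≡_; _≢_)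
open import Relation.Nullary using (¬_; yes; no; contradiction)

import Algebra.Properties.CommutativeMonoid.Sum as Sum
import Algebra.Properties.CommutativeSemiring.Exp as CommutativeExp
import Algebra.Properties.CommutativeSemiring.Binomial as Binomial
import Algebra.Properties.Ring as RingProperties
import Algebra.Properties.Semiring.Exp as Exp
import Algebra.Properties.Semiring.Mult as Mult

open Sum ℕ.+-0-commutativeMonoid using () renaming (sum to ∑) public

------------------------------------------------------------------------
-- Cardinality

HasSize : ∀ {a ℓ} → Setoid a ℓ → ℕ → Set (a ⊔ ℓ)
HasSize S n = Inverse (≡.setoid (Fin n)) S

subsetoid : ∀ {a ℓ p} (S : Setoid a ℓ) → (Setoid.Carrier S → Set p) → Setoid (a ⊔ p) ℓ
subsetoid S P = On.setoid {B = Σ (Setoid.Carrier S) P} S proj₁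

------------------------------------------------------------------------
-- Fields

record Field c ℓ : Set (lsuc (c ⊔ ℓ)) where
  field
    commutativeRing : CommutativeRing c ℓ
  open CommutativeRing commutativeRing public hiding (zero)
  field
    _≟_     : Decidable _≈_
    1≉0     : ¬ (1# ≈ 0#)
    inverse : ∀ x → ¬ (x ≈ 0#) → ∃ λ y → x * y ≈ 1#

  infixl 7 _/_

  -- Division by zero is given the junk value 0.
  _/_ : Carrier → Carrier → Carrier
  x / y with y ≟ 0#
  ... | yes _   = 0#
  ... | no  y≉0 = x * proj₁ (inverse y y≉0)

  open Exp semiring public using (_^_)
  open Mult semiring public using () renaming (_×_ to _·_)
  open Sum +-commutativeMonoid public using (sum)
  open Sum *-commutativeMonoid public using () renaming (sum to product)

  monic : ∀ {n} → Vector Carrier n → Carrier → Carrier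
  monic {n} a x = x ^ n + sum (λ i → a i * x ^ toℕ i)

-- k has q = pʳ elements.
record IsFiniteField {c ℓ} (k : Field c ℓ) (p r : ℕ) : Set (c ⊔ ℓ) where
  field
    prime : Prime p
    size  : HasSize (Field.setoid k) (p ℕ.^ r)

record AlgebraicClosure {c ℓ c′ ℓ′} (k : Field c ℓ) (K : Field c′ ℓ′) : Set (c ⊔ ℓ ⊔ c′ ⊔ ℓ′) where
  private
    module k = Field k
    module K = Field K
  field
    ι                  : k.Carrier → K.Carrier
    isRingHomomorphism : RingMorphisms.IsRingHomomorphism k.rawRing K.rawRing ι
    algebraic          : ∀ x → ∃ λ n → ∃ λ (a : Vector k.Carrier n) → K.monic (ι ∘ a) x K.≈ K.0#
    closed             : ∀ n (a : Vector K.Carrier (suc n)) → ∃ λ x → K.monic a x K.≈ K.0#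

------------------------------------------------------------------------
-- The q-power map

module FieldProperties {c ℓ} (F : Field c ℓ) where
  open Field F
  open import Relation.Binary.Reasoning.Setoid setoid
  open RingProperties ring using (+-cancelˡ)
  private
    module S = Sum +-commutativeMonoid
    module P = Sum *-commutativeMonoid
  open Exp semiring using (^-congˡ; ^-congʳ; ^-homo-*; ^-assocʳ)
  open CommutativeExp commutativeSemiring using (^-distrib-*)
  open Mult semiring using (×-assocˡ; ×-congʳ; ×-congˡ; ×1-homo-*; ×-assoc-*; ×-homo-0#)

  *-cancelˡ-≉0 : ∀ {x} y z → ¬ (x ≈ 0#) → x * y ≈ x * z → y ≈ z
  *-cancelˡ-≉0 {x} y z x≉0 xy≈xz = begin
    y               ≈⟨ undo y ⟨
    x⁻¹ * (x * y)   ≈⟨ *-congˡ xy≈xz ⟩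
    x⁻¹ * (x * z)   ≈⟨ undo z ⟩
    z               ∎
    where
    x⁻¹ = proj₁ (inverse x x≉0)
    undo : ∀ w → x⁻¹ * (x * w) ≈ w
    undo w = begin
      x⁻¹ * (x * w)  ≈⟨ *-assoc _ _ _ ⟨
      x⁻¹ * x * w    ≈⟨ *-congʳ (trans (*-comm _ _) (proj₂ (inverse x x≉0))) ⟩
      1# * w         ≈⟨ *-identityˡ w ⟩
      w              ∎

  *-≉0 : ∀ {x y} → ¬ (x ≈ 0#) → ¬ (y ≈ 0#) → ¬ (x * y ≈ 0#)
  *-≉0 {x} {y} x≉0 y≉0 xy≈0 = y≉0 (*-cancelˡ-≉0 y 0# x≉0 (trans xy≈0 (sym (zeroʳ x))))

  ^-≉0 : ∀ {x} n → ¬ (x ≈ 0#) → ¬ (x ^ n ≈ 0#)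
  ^-≉0 zero    x≉0 = 1≉0
  ^-≉0 (suc n) x≉0 = *-≉0 x≉0 (^-≉0 n x≉0)

  inverse-≉0 : ∀ {x y} → x * y ≈ 1# → ¬ (y ≈ 0#)
  inverse-≉0 {x} xy≈1 y≈0 = 1≉0 (trans (sym xy≈1) (trans (*-congˡ y≈0) (zeroʳ x)))

  ^≈0⇒≈0 : ∀ x n → x ^ n ≈ 0# → x ≈ 0#
  ^≈0⇒≈0 x n x^n≈0 with x ≟ 0#
  ... | yes x≈0 = x≈0
  ... | no  x≉0 = contradiction x^n≈0 (^-≉0 n x≉0)

  0^n≈0 : ∀ n → .{{NonZero n}} → 0# ^ n ≈ 0#
  0^n≈0 (suc n) = zeroˡ _

  1^n≈1 : ∀ n → 1# ^ n ≈ 1#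
  1^n≈1 zero    = refl
  1^n≈1 (suc n) = trans (*-identityˡ _) (1^n≈1 n)

  ·1≈ : ∀ n x → n · x ≈ (n · 1#) * x
  ·1≈ n x = begin
    n · x          ≈⟨ ×-congʳ n (*-identityˡ x) ⟨
    n · (1# * x)   ≈⟨ ×-assoc-* n 1# x ⟨
    (n · 1#) * x   ∎

  ^·1 : ∀ m n → (m ℕ.^ n) · 1# ≈ (m · 1#) ^ n
  ^·1 m zero    = +-identityʳ 1#
  ^·1 m (suc n) = trans (×1-homo-* m (m ℕ.^ n)) (*-congˡ (^·1 m n))

  module Finite {n} (size : HasSize setoid n) where
    open Inverse size using (to; from; from-cong; strictlyInverseˡ; strictlyInverseʳ)

    translate : (f g : Carrier → Carrier) →
                (∀ {x y} → x ≈ y → f x ≈ f y) → (∀ {x y} → x ≈ y → g x ≈ g y) →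
                (∀ x → f (g x) ≈ x) → (∀ x → g (f x) ≈ x) → Permutation n n
    translate f g f-cong g-cong fg gf = permutation (λ i → from (f (to i))) (λ i → from (g (to i)))
      (λ i → ≡.trans (from-cong (trans (f-cong (strictlyInverseˡ _)) (fg _))) (strictlyInverseʳ i))
      (λ i → ≡.trans (from-cong (trans (g-cong (strictlyInverseˡ _)) (gf _))) (strictlyInverseʳ i))

    n·1≈0 : n · 1# ≈ 0#
    n·1≈0 = +-cancelˡ (sum to) _ _ (begin
      sum to + n · 1#                        ≈⟨ +-congˡ (S.sum-replicate n) ⟨
      sum to + sum {n} (λ _ → 1#)            ≈⟨ S.∑-distrib-+ to _ ⟨
      sum (λ i → to i + 1#)                  ≈⟨ S.sum-cong-≋ {n} (λ i → strictlyInverseˡ _) ⟨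
      sum (λ i → to (from (to i + 1#)))      ≈⟨ S.sum-permute to shift ⟨
      sum to                                 ≈⟨ +-identityʳ _ ⟨
      sum to + 0#                            ∎)
      where
      cancel : ∀ x y z → y + z ≈ 0# → (x + y) + z ≈ x
      cancel x y z e = trans (+-assoc x y z) (trans (+-congˡ e) (+-identityʳ x))
      shift = translate (_+ 1#) (_+ - 1#) +-congʳ +-congʳ
        (λ x → cancel x _ _ (-‿inverseˡ 1#)) (λ x → cancel x _ _ (-‿inverseʳ 1#))

    -- a is x on 0 and 1 elsewhere; b is 1 on 0 and the identity elsewhere
    a b : Carrier → Carrier → Carrier
    a x y with y ≟ 0#
    ... | yes _ = x
    ... | no  _ = 1#
    b x y with y ≟ 0#
    ... | yes _ = 1#
    ... | no  _ = y

    a-at-0 : ∀ {x y} → y ≈ 0# → a x y ≈ x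
    a-at-0 {x} {y} y≈0 with y ≟ 0#
    ... | yes _   = refl
    ... | no  y≉0 = contradiction y≈0 y≉0

    a-off-0 : ∀ {x y} → ¬ (y ≈ 0#) → a x y ≈ 1#
    a-off-0 {x} {y} y≉0 with y ≟ 0#
    ... | yes y≈0 = contradiction y≈0 y≉0
    ... | no  _   = refl

    b≉0 : ∀ {x} y → ¬ (b x y ≈ 0#)
    b≉0 y with y ≟ 0#
    ... | yes _   = 1≉0
    ... | no  y≉0 = y≉0

    ab : ∀ {x} y z → ¬ (x ≈ 0#) → z ≈ x * y → b x z * a x y ≈ x * b x y
    ab {x} y z x≉0 z≈xy with y ≟ 0# | z ≟ 0#
    ... | yes _   | yes _   = *-comm _ _
    ... | yes y≈0 | no  z≉0 = contradiction (trans z≈xy (trans (*-congˡ y≈0) (zeroʳ x))) z≉0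
    ... | no  y≉0 | yes z≈0 = contradiction (trans (sym z≈xy) z≈0) (*-≉0 x≉0 y≉0)
    ... | no  _   | no  _   = trans (*-identityʳ z) z≈xy

    product-≉0 : ∀ {m} (f : Vector Carrier m) → (∀ i → ¬ (f i ≈ 0#)) → ¬ (product f ≈ 0#)
    product-≉0 {zero}  f f≉0 = 1≉0
    product-≉0 {suc m} f f≉0 = *-≉0 (f≉0 zero) (product-≉0 (f ∘ suc) (f≉0 ∘ suc))

    product-one : ∀ {m} (f : Vector Carrier m) (i : Fin m) → (∀ j → j ≢ i → f j ≈ 1#) → product f ≈ f i
    product-one {suc m} f i f≈1 = begin
      product f                            ≈⟨ P.sum-remove {i = i} f ⟩
      f i * product (Vector.removeAt f i)  ≈⟨ *-congˡ (P.sum-cong-≋ {m} (λ j → f≈1 _ (Fin.punchInᵢ≢i i j))) ⟩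
      f i * product {m} (λ _ → 1#)         ≈⟨ *-congˡ (trans (P.sum-replicate m) (1^n≈1 m)) ⟩
      f i * 1#                             ≈⟨ *-identityʳ _ ⟩
      f i                                  ∎

    -- Compare the product of all nonzero y with that of all x * y.
    fermat : .{{NonZero n}} → ∀ x → x ^ n ≈ x
    fermat x with x ≟ 0#
    ... | yes x≈0 = trans (^-congˡ n x≈0) (trans (0^n≈0 n) (sym x≈0))
    ... | no  x≉0 = *-cancelˡ-≉0 _ _ (product-≉0 (b x ∘ to) (λ i → b≉0 {x} (to i))) (begin
        B * x ^ n                            ≈⟨ *-comm _ _ ⟩
        x ^ n * B                            ≈⟨ *-congʳ (P.sum-replicate n) ⟨
        product {n} (λ _ → x) * B            ≈⟨ P.∑-distrib-+ {n} (λ _ → x) (b x ∘ to) ⟨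
        product (λ i → x * b x (to i))       ≈⟨ P.sum-cong-≋ (λ i → ab (to i) _ x≉0 (strictlyInverseˡ _)) ⟨
        product (λ i → b x (to (from (x * to i))) * a x (to i))
          ≈⟨ P.∑-distrib-+ (λ i → b x (to (from (x * to i)))) (a x ∘ to) ⟩
        product (λ i → b x (to (from (x * to i)))) * product (a x ∘ to)
          ≈⟨ *-cong (P.sum-permute (b x ∘ to) scale) refl ⟨
        B * product (a x ∘ to)               ≈⟨ *-congˡ (product-one (a x ∘ to) (from 0#) off) ⟩
        B * a x (to (from 0#))               ≈⟨ *-congˡ (a-at-0 (strictlyInverseˡ 0#)) ⟩
        B * x                                ∎)
      where
      B = product (b x ∘ to)
      x⁻¹ = proj₁ (inverse x x≉0)
      undo : ∀ {u v} → u * v ≈ 1# → ∀ w → u * (v * w) ≈ w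
      undo uv≈1 w = trans (sym (*-assoc _ _ w)) (trans (*-congʳ uv≈1) (*-identityˡ w))
      scale = translate (x *_) (x⁻¹ *_) *-congˡ *-congˡ
        (undo (proj₂ (inverse x x≉0))) (undo (trans (*-comm _ _) (proj₂ (inverse x x≉0))))
      off : ∀ j → j ≢ from 0# → a x (to j) ≈ 1#
      off j j≢ = a-off-0 (λ e → j≢ (≡.trans (≡.sym (strictlyInverseʳ j)) (from-cong e)))

  module Characteristic {p} (prime : Prime p) (p·1≈0 : p · 1# ≈ 0#) where

    p∤k! : ∀ k → k < p → ¬ (p ∣ k !)
    p∤k! zero    _   p∣1 = ℕ.<⇒≱ (ℕ.nonTrivial⇒n>1 p {{prime⇒nonTrivial prime}}) (∣⇒≤ p∣1)
    p∤k! (suc k) k<p p∣  with euclidsLemma (suc k) (k !) prime p∣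
    ... | inj₁ p∣k+1 = ℕ.<⇒≱ k<p (∣⇒≤ p∣k+1)
    ... | inj₂ p∣k!  = p∤k! k (ℕ.<-trans (ℕ.n<1+n k) k<p) p∣k!

    n∣n! : ∀ {n} → .{{NonZero n}} → n ∣ n !
    n∣n! {suc n} = m∣m*n (n !)

    p∣pCk : ∀ k → 0 < k → k < p → p ∣ p C k
    p∣pCk k 0<k k<p with euclidsLemma (p C k) (k ! ℕ.* (p ℕ.∸ k) !) prime p∣C*d
      where
      instance _ = prime⇒nonZero prime
      instance _ = k ℕ.!* (p ℕ.∸ k) !≢0
      k≤p = ℕ.<⇒≤ k<p
      p∣C*d : p ∣ (p C k) ℕ.* (k ! ℕ.* (p ℕ.∸ k) !)
      p∣C*d = ≡.subst (p ∣_)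
        (≡.sym (≡.trans (≡.cong (ℕ._* (k ! ℕ.* (p ℕ.∸ k) !)) (nCk≡n!/k![n-k]! k≤p))
                        (m/n*n≡m (k![n∸k]!∣n! k≤p)))) n∣n!
    ... | inj₁ p∣C = p∣C
    ... | inj₂ p∣d with euclidsLemma (k !) _ prime p∣d
    ... | inj₁ p∣k! = contradiction p∣k! (p∤k! k k<p)
    ... | inj₂ p∣l! = contradiction p∣l! (p∤k! _ (ℕ.∸-monoʳ-< 0<k (ℕ.<⇒≤ k<p)))

    ∣⇒·≈0 : ∀ {n} x → p ∣ n → n · x ≈ 0#
    ∣⇒·≈0 x (divides m ≡.refl) = begin
      (m ℕ.* p) · x     ≈⟨ ×-assocˡ x m p ⟨
      m · (p · x)       ≈⟨ ×-congʳ m (trans (·1≈ p x) (trans (*-congʳ p·1≈0) (zeroˡ x))) ⟩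
      m · 0#            ≈⟨ trans (·1≈ m 0#) (zeroʳ _) ⟩
      0#                ∎

    freshman : ∀ m → p ≡ suc m → ∀ x y → (x + y) ^ p ≈ x ^ p + y ^ p
    freshman m ≡.refl x y = begin
      (x + y) ^ p
        ≈⟨ Binomial.theorem commutativeSemiring p x y ⟩
      t zero + sum (t ∘ suc)
        ≈⟨ +-cong t₀ (S.sum-init-last (t ∘ suc)) ⟩
      y ^ p + (sum (Vector.init (t ∘ suc)) + Vector.last (t ∘ suc))
        ≈⟨ +-congˡ (+-cong (trans (S.sum-cong-≋ {m} middle) (S.sum-replicate-zero m)) tₗ) ⟩
      y ^ p + (0# + x ^ p)
        ≈⟨ trans (+-congˡ (+-identityˡ _)) (+-comm _ _) ⟩
      x ^ p + y ^ p
        ∎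
      where
      t = Binomial.binomialTerm commutativeSemiring x y p
      t₀ : t zero ≈ y ^ p
      t₀ = trans (+-identityʳ _) (*-identityˡ _)
      middle : ∀ i → t (suc (Fin.inject₁ i)) ≈ 0#
      middle i = ∣⇒·≈0 _ (p∣pCk _ (ℕ.s≤s ℕ.z≤n)
        (ℕ.s≤s (≡.subst (_< m) (≡.sym (Fin.toℕ-inject₁ i)) (Fin.toℕ<n i))))
      tₗ : Vector.last (t ∘ suc) ≈ x ^ p
      tₗ = begin
        (p C toℕ (suc (Fin.fromℕ m))) · (x ^ toℕ (suc (Fin.fromℕ m)) * y ^ (p ℕ.∸ toℕ (suc (Fin.fromℕ m))))
          ≈⟨ reflexive (≡.cong (λ j → (p C j) · (x ^ j * y ^ (p ℕ.∸ j))) (≡.cong suc (Fin.toℕ-fromℕ m))) ⟩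
        (p C p) · (x ^ p * y ^ (p ℕ.∸ p))
          ≈⟨ reflexive (≡.cong₂ (λ j l → j · (x ^ p * y ^ l)) (nCn≡1 p) (ℕ.n∸n≡0 p)) ⟩
        1 · (x ^ p * 1#)
          ≈⟨ trans (+-identityʳ _) (*-identityʳ _) ⟩
        x ^ p ∎

    ^pʳ-+ : ∀ r x y → (x + y) ^ (p ℕ.^ r) ≈ x ^ (p ℕ.^ r) + y ^ (p ℕ.^ r)
    ^pʳ-+ zero    x y = trans (*-identityʳ _) (+-cong (sym (*-identityʳ _)) (sym (*-identityʳ _)))
    ^pʳ-+ (suc r) x y = begin
      (x + y) ^ (p ℕ.* q)            ≈⟨ ^-assocʳ (x + y) p q ⟨
      ((x + y) ^ p) ^ q              ≈⟨ ^-congˡ q (freshman (ℕ.pred p) (≡.sym (ℕ.suc-pred p)) x y) ⟩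
      (x ^ p + y ^ p) ^ q            ≈⟨ ^pʳ-+ r _ _ ⟩
      (x ^ p) ^ q + (y ^ p) ^ q      ≈⟨ +-cong (^-assocʳ x p q) (^-assocʳ y p q) ⟩
      x ^ (p ℕ.* q) + y ^ (p ℕ.* q)  ∎
      where
      q = p ℕ.^ r
      instance _ = prime⇒nonZero prime

  module FieldSize {p r} (finite : IsFiniteField F p r) where
    open IsFiniteField finite
    private instance
      p≢0 = prime⇒nonZero prime
      q≢0 = ℕ.m^n≢0 p r

    ^q-fixes : ∀ x → x ^ (p ℕ.^ r) ≈ x
    ^q-fixes = Finite.fermat size

    p·1≈0 : p · 1# ≈ 0#
    p·1≈0 = ^≈0⇒≈0 _ r (trans (sym (^·1 p r)) (Finite.n·1≈0 size))

module Frobenius {c ℓ c′ ℓ′} {k : Field c ℓ} {K : Field c′ ℓ′} {p r}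
                 (finite : IsFiniteField k p r) (closure : AlgebraicClosure k K) where
  private
    module k = Field k
    module kₚ = FieldProperties k
  open Field K
  open FieldProperties K
  open IsFiniteField finite using (prime)
  open AlgebraicClosure closure
  open RingMorphisms.IsRingHomomorphism isRingHomomorphism
    using (⟦⟧-cong; +-homo; *-homo; 0#-homo; 1#-homo)
  open RingProperties ring using (x∙y⁻¹≈ε⇒x≈y)
  open Exp semiring using (^-congˡ; ^-congʳ)
  open CommutativeExp commutativeSemiring using (^-distrib-*)
  open import Relation.Binary.Reasoning.Setoid setoid
  private instance
    p≢0 = prime⇒nonZero prime
    q≢0 = ℕ.m^n≢0 p r

  q : ℕ
  q = p ℕ.^ r

  ι-· : ∀ n → ι (n k.· k.1#) ≈ n · 1#
  ι-· zero    = 0#-homo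
  ι-· (suc n) = trans (+-homo _ _) (+-cong 1#-homo (ι-· n))

  ι-^ : ∀ x n → ι (x k.^ n) ≈ ι x ^ n
  ι-^ x zero    = 1#-homo
  ι-^ x (suc n) = trans (*-homo _ _) (*-congˡ (ι-^ x n))

  ^q-ι : ∀ x → ι x ^ q ≈ ι x
  ^q-ι x = trans (sym (ι-^ x q)) (⟦⟧-cong (kₚ.FieldSize.^q-fixes finite x))

  ^q-+ : ∀ x y → (x + y) ^ q ≈ x ^ q + y ^ q
  ^q-+ = Characteristic.^pʳ-+ prime
    (trans (sym (ι-· p)) (trans (⟦⟧-cong (kₚ.FieldSize.p·1≈0 finite)) 0#-homo)) r

  ^q-* : ∀ x y → (x * y) ^ q ≈ x ^ q * y ^ q
  ^q-* x y = ^-distrib-* x y q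

  ^q-0 : 0# ^ q ≈ 0#
  ^q-0 = 0^n≈0 q

  ^q-injective : ∀ x y → x ^ q ≈ y ^ q → x ≈ y
  ^q-injective x y e = x∙y⁻¹≈ε⇒x≈y x y (^≈0⇒≈0 (x + - y) q (begin
    (x + - y) ^ q       ≈⟨ ^q-+ x (- y) ⟩
    x ^ q + (- y) ^ q   ≈⟨ +-congʳ e ⟩
    y ^ q + (- y) ^ q   ≈⟨ ^q-+ y (- y) ⟨
    (y + - y) ^ q       ≈⟨ ^-congˡ q (-‿inverseʳ y) ⟩
    0# ^ q              ≈⟨ ^q-0 ⟩
    0#                  ∎))

  root : ∀ x → ∃ λ y → y ^ q ≈ x
  root x = ≡.subst (λ n → ∃ λ y → y ^ n ≈ x) (ℕ.suc-pred q) (sucRoot (ℕ.pred q))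
    where
    sucRoot : ∀ n → ∃ λ y → y ^ suc n ≈ x
    sucRoot n with closed n (- x Vector.∷ λ _ → 0#)
    ... | y , e = y , x∙y⁻¹≈ε⇒x≈y _ x (begin
      y ^ suc n + - x
        ≈⟨ +-congˡ (trans (+-identityʳ _) (*-identityʳ _)) ⟨
      y ^ suc n + (- x * 1# + 0#)
        ≈⟨ +-congˡ (+-congˡ (trans (Sum.sum-cong-≋ +-commutativeMonoid {n} (λ _ → zeroˡ _))
                                   (Sum.sum-replicate-zero +-commutativeMonoid n))) ⟨
      y ^ suc n + (- x * 1# + sum {n} (λ i → 0# * y ^ suc (toℕ i)))
        ≈⟨ e ⟩
      0# ∎)

------------------------------------------------------------------------
-- Projective algebraic sets and their morphisms

-- A homogeneous polynomial of degree d in n variables, as a list of terms.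
Form : ∀ {a} → Set a → ℕ → ℕ → Set a
Form A n d = List (A × ∃ λ (e : Vector ℕ n) → ∑ e ≡ d)

mapForm : ∀ {a b n d} {A : Set a} {B : Set b} → (A → B) → Form A n d → Form B n d
mapForm j = List.map (λ (a , m) → j a , m)

Forms : ∀ {a} → Set a → ℕ → Set a
Forms A n = List (∃ λ d → Form A n d)

mapForms : ∀ {a b n} {A : Set a} {B : Set b} → (A → B) → Forms A n → Forms B n
mapForms j = List.map (λ (d , f) → d , mapForm j f)

-- A closed subset of projective dim-space, with equations over A.
record ProjectiveSet {a} (A : Set a) : Set a where
  field
    dim       : ℕ
    equations : Forms A (suc dim)

baseChange : ∀ {a b} {A : Set a} {B : Set b} → (A → B) → ProjectiveSet A → ProjectiveSet B
baseChange j X = record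
  { dim       = X.dim
  ; equations = mapForms j X.equations
  }
  where module X = ProjectiveSet X

-- Over an algebraically closed K, a closed subset is identified with its
-- K-points and a morphism with the map it induces on them.
module Geometry {c ℓ} (K : Field c ℓ) where
  open Field K
  open FieldProperties K
  open ProjectiveSet using (dim; equations)
  open import Relation.Binary.Reasoning.Setoid setoid

  eval : ∀ {n d} → Form Carrier n d → Vector Carrier n → Carrier
  eval []                x = 0#
  eval ((a , e , _) ∷ f) x = a * product (λ i → x i ^ e i) + eval f x

  Vanish : ∀ {n} → Forms Carrier n → Vector Carrier n → Set (c ⊔ ℓ)
  Vanish fs x = All (λ (_ , f) → eval f x ≈ 0#) fs

  record Point (X : ProjectiveSet Carrier) : Set (c ⊔ ℓ) where
    field
      coord   : Vector Carrier (suc (dim X))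
      nonzero : ∃ λ i → ¬ (coord i ≈ 0#)
      on      : Vanish (equations X) coord

  open Point public

  _∼_ : ∀ {n} → Vector Carrier n → Vector Carrier n → Set (c ⊔ ℓ)
  x ∼ y = ∃ λ s → ¬ (s ≈ 0#) × ∀ i → y i ≈ s * x i

  ∼-refl : ∀ {n} (x : Vector Carrier n) → x ∼ x
  ∼-refl x = 1# , 1≉0 , λ i → sym (*-identityˡ (x i))

  ∼-sym : ∀ {n} {x y : Vector Carrier n} → x ∼ y → y ∼ x
  ∼-sym {x = x} {y} (s , s≉0 , y≈sx) = t , inverse-≉0 st≈1 , λ i → begin
    x i            ≈⟨ *-identityˡ _ ⟨
    1# * x i       ≈⟨ *-congʳ (trans (*-comm t s) st≈1) ⟨
    t * s * x i    ≈⟨ *-assoc _ _ _ ⟩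
    t * (s * x i)  ≈⟨ *-congˡ (y≈sx i) ⟨
    t * y i        ∎
    where
    t    = proj₁ (inverse s s≉0)
    st≈1 = proj₂ (inverse s s≉0)

  ∼-trans : ∀ {n} {x y z : Vector Carrier n} → x ∼ y → y ∼ z → x ∼ z
  ∼-trans (s , s≉0 , y≈sx) (t , t≉0 , z≈ty) =
    t * s , *-≉0 t≉0 s≉0 , λ i → trans (z≈ty i) (trans (*-congˡ (y≈sx i)) (sym (*-assoc t s _)))

  Points : ProjectiveSet Carrier → Setoid (c ⊔ ℓ) (c ⊔ ℓ)
  Points X = record
    { Carrier       = Point X
    ; _≈_           = λ P Q → coord P ∼ coord Q
    ; isEquivalence = record
      { refl  = λ {P} → ∼-refl (coord P)
      ; sym   = ∼-sym
      ; trans = ∼-trans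
      }
    }

  -- φ is given near P by forms of one degree with coefficients in the image of j.
  RegularAt : ∀ {a} {A : Set a} → (A → Carrier) → ∀ {X Z} → (Point X → Point Z) → Point X → Set (a ⊔ c ⊔ ℓ)
  RegularAt {A = A} j {X} {Z} φ P =
    ∃ λ d → ∃ λ (f : Vector (Form A (suc (dim X)) d) (suc (dim Z))) →
      let F = λ R i → eval (mapForm j (f i)) (coord R) in
      (∃ λ i → ¬ (F P i ≈ 0#)) ×
      (∀ (R : Point X) → (∃ λ i → ¬ (F R i ≈ 0#)) → F R ∼ coord (φ R))

  record MorphismOver {a} {A : Set a} (j : A → Carrier) (X Z : ProjectiveSet Carrier) : Set (a ⊔ c ⊔ ℓ) where
    field
      func    : Func (Points X) (Points Z)
      regular : ∀ P → RegularAt j {X} {Z} (Func.to func) P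

    open Func func public renaming (to to infixr 9 _⟨$⟩_)

  Morphism : ProjectiveSet Carrier → ProjectiveSet Carrier → Set (c ⊔ ℓ)
  Morphism = MorphismOver id

  open MorphismOver public using (_⟨$⟩_)

  -- P lies in X(k), where j embeds k in K.
  IsRational : ∀ {a} {A : Set a} → (A → Carrier) → ∀ {X} → Point X → Set (a ⊔ c ⊔ ℓ)
  IsRational {A = A} j {X} P = ∃ λ (x : Vector A (suc (dim X))) → (j ∘ x) ∼ coord P

  IsAutomorphism : ∀ {X} → Morphism X X → Set (c ⊔ ℓ)
  IsAutomorphism {X} φ = ∃ λ (ψ : Morphism X X) → ∀ P → φ ⟨$⟩ (ψ ⟨$⟩ P) ≋ P × ψ ⟨$⟩ (φ ⟨$⟩ P) ≋ P
    where open Setoid (Points X) using () renaming (_≈_ to _≋_)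

module FrobeniusOnPoints {c ℓ c′ ℓ′} {k : Field c ℓ} {K : Field c′ ℓ′} {p r}
                         (finite : IsFiniteField k p r) (closure : AlgebraicClosure k K)
                         (X : ProjectiveSet (Field.Carrier k)) where
  open Field K
  open FieldProperties K
  open AlgebraicClosure closure
  open Geometry K
  open Frobenius finite closure
  open ProjectiveSet X using (dim; equations)
  open Exp semiring using (^-congˡ; ^-assocʳ; ^-congʳ)
  open import Relation.Binary.Reasoning.Setoid setoid
  private instance
    q≢0 = ℕ.m^n≢0 p r {{prime⇒nonZero (IsFiniteField.prime finite)}}

  X̄ = baseChange ι X

  ^-comm : ∀ x m n → (x ^ m) ^ n ≈ (x ^ n) ^ m
  ^-comm x m n = begin
    (x ^ m) ^ n    ≈⟨ ^-assocʳ x m n ⟩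
    x ^ (m ℕ.* n)  ≈⟨ ^-congʳ x (ℕ.*-comm m n) ⟩
    x ^ (n ℕ.* m)  ≈⟨ ^-assocʳ x n m ⟨
    (x ^ n) ^ m    ∎

  product-^q : ∀ {n} (f : Vector Carrier n) → product (λ i → f i ^ q) ≈ product f ^ q
  product-^q {zero}  f = sym (1^n≈1 q)
  product-^q {suc n} f = trans (*-congˡ (product-^q (f ∘ suc))) (sym (^q-* _ _))

  eval-^q : ∀ {n d} (f : Form (Field.Carrier k) n d) {x y : Vector Carrier n} → (∀ i → y i ≈ x i ^ q) →
            eval (mapForm ι f) y ≈ eval (mapForm ι f) x ^ q
  eval-^q []                        y≈xq = sym ^q-0
  eval-^q {n} ((a , e , _) ∷ f) {x} {y} y≈xq = begin
    ι a * product (λ i → y i ^ e i) + eval (mapForm ι f) y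
      ≈⟨ +-cong (*-cong (sym (^q-ι a)) term) (eval-^q f y≈xq) ⟩
    ι a ^ q * product (λ i → x i ^ e i) ^ q + eval (mapForm ι f) x ^ q
      ≈⟨ +-congʳ (^q-* _ _) ⟨
    (ι a * product (λ i → x i ^ e i)) ^ q + eval (mapForm ι f) x ^ q
      ≈⟨ ^q-+ _ _ ⟨
    (ι a * product (λ i → x i ^ e i) + eval (mapForm ι f) x) ^ q ∎
    where
    term : product (λ i → y i ^ e i) ≈ product (λ i → x i ^ e i) ^ q
    term = trans
      (Sum.sum-cong-≋ *-commutativeMonoid {n} (λ i → trans (^-congˡ (e i) (y≈xq i)) (^-comm (x i) q (e i))))
      (product-^q (λ i → x i ^ e i))

  on-^q : ∀ {x y : Vector Carrier (suc dim)} → (∀ i → y i ≈ x i ^ q) → ∀ fs →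
          Vanish (mapForms ι fs) x →
          Vanish (mapForms ι fs) y
  on-^q y≈xq []             []       = []
  on-^q y≈xq ((_ , f) ∷ fs) (h ∷ hs) =
    trans (eval-^q f y≈xq) (trans (^-congˡ q h) ^q-0) ∷ on-^q y≈xq fs hs

  on-root : ∀ {x y : Vector Carrier (suc dim)} → (∀ i → y i ≈ x i ^ q) → ∀ fs →
            Vanish (mapForms ι fs) y →
            Vanish (mapForms ι fs) x
  on-root y≈xq []             []       = []
  on-root y≈xq ((_ , f) ∷ fs) (h ∷ hs) =
    ^≈0⇒≈0 _ q (trans (sym (eval-^q f y≈xq)) h) ∷ on-root y≈xq fs hs

  √ : Carrier → Carrier
  √ x = proj₁ (root x)

  √-^q : ∀ x → √ x ^ q ≈ x
  √-^q x = proj₂ (root x)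

  ^q≈0⇒ : ∀ {x y} → y ≈ x ^ q → x ≈ 0# → y ≈ 0#
  ^q≈0⇒ y≈xq x≈0 = trans y≈xq (trans (^-congˡ q x≈0) ^q-0)

  to : Point X̄ → Point X̄
  to P = record
    { coord   = λ i → coord P i ^ q
    ; nonzero = proj₁ (nonzero P) , ^-≉0 q (proj₂ (nonzero P))
    ; on      = on-^q (λ _ → refl) equations (on P)
    }

  from : Point X̄ → Point X̄
  from P = record
    { coord   = λ i → √ (coord P i)
    ; nonzero = proj₁ (nonzero P) , λ e → proj₂ (nonzero P) (^q≈0⇒ (sym (√-^q _)) e)
    ; on      = on-root (λ i → sym (√-^q (coord P i))) equations (on P)
    }

  to-cong : ∀ {n} {x y : Vector Carrier n} → x ∼ y → (λ i → x i ^ q) ∼ (λ i → y i ^ q)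
  to-cong (s , s≉0 , y≈sx) = s ^ q , ^-≉0 q s≉0 , λ i → trans (^-congˡ q (y≈sx i)) (^q-* s _)

  ∼-root : ∀ {n} {x y : Vector Carrier n} → (λ i → x i ^ q) ∼ (λ i → y i ^ q) → x ∼ y
  ∼-root {x = x} (s , s≉0 , e) = √ s , (λ √s≈0 → s≉0 (^q≈0⇒ (sym (√-^q s)) √s≈0)) , λ i →
    ^q-injective _ _ (trans (e i) (trans (*-congʳ (sym (√-^q s))) (sym (^q-* (√ s) (x i)))))

  from-^q : ∀ (P : Point X̄) → coord P ∼ coord (to (from P))
  from-^q P = 1# , 1≉0 , λ i → trans (√-^q (coord P i)) (sym (*-identityˡ _))

  from-unique : ∀ (P R : Point X̄) → coord P ∼ coord (to R) → coord (from P) ∼ coord R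
  from-unique P R e = ∼-root {x = coord (from P)} {y = coord R}
    (∼-trans {x = coord (to (from P))} {coord P} {coord (to R)}
      (∼-sym {x = coord P} {coord (to (from P))} (from-^q P)) e)

  to-unique : ∀ (P R : Point X̄) → coord R ∼ coord (from P) → coord (to R) ∼ coord P
  to-unique P R e = ∼-trans {x = coord (to R)} {coord (to (from P))} {coord P}
    (to-cong {x = coord R} {coord (from P)} e)
    (∼-sym {x = coord P} {coord (to (from P))} (from-^q P))

  -- The q-power Frobenius is a bijection on geometric points.
  𝓕 : Inverse (Points X̄) (Points X̄)
  𝓕 = record
    { to        = to
    ; from      = from
    ; to-cong   = λ {P} {R} → to-cong {x = coord P} {coord R}
    ; from-cong = λ {P} {R} e → from-unique P (from R)
                    (∼-trans {x = coord P} {coord R} {coord (to (from R))} e (from-^q R))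
    ; inverse   = (λ {P} {R} → to-unique P R) , (λ {P} {R} → λ e → from-unique R P e)
    }

------------------------------------------------------------------------
-- Elliptic curves

record WeierstrassCurve {c ℓ} (k : Field c ℓ) : Set c where
  open Field k
  field
    a₁ a₂ a₃ a₄ a₆ : Carrier

  b₂ b₄ b₆ b₈ Δ : Carrier
  b₂ = a₁ ^ 2 + 4 · a₂
  b₄ = 2 · a₄ + a₁ * a₃
  b₆ = a₃ ^ 2 + 4 · a₆
  b₈ = a₁ ^ 2 * a₆ + 4 · (a₂ * a₆) + - (a₁ * a₃ * a₄) + a₂ * a₃ ^ 2 + - (a₄ ^ 2)
  Δ  = - (b₂ ^ 2 * b₈) + - (8 · (b₄ ^ 3)) + - (27 · (b₆ ^ 2)) + 9 · (b₂ * b₄ * b₆)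

  -- Y²Z + a₁XYZ + a₃YZ² - X³ - a₂X²Z - a₄XZ² - a₆Z³
  equation : Form Carrier 3 3
  equation = term 1#     0 2 1 ≡.refl
           ∷ term a₁     1 1 1 ≡.refl
           ∷ term a₃     0 1 2 ≡.refl
           ∷ term (- 1#) 3 0 0 ≡.refl
           ∷ term (- a₂) 2 0 1 ≡.refl
           ∷ term (- a₄) 1 0 2 ≡.refl
           ∷ term (- a₆) 0 0 3 ≡.refl
           ∷ []
    where
    term : Carrier → ∀ x y z → x ℕ.+ (y ℕ.+ (z ℕ.+ 0)) ≡ 3 →
           Carrier × ∃ λ (e : Vector ℕ 3) → ∑ e ≡ 3
    term a x y z d = a , (x Vector.∷ y Vector.∷ z Vector.∷ Vector.[]) , d

  projective : ProjectiveSet Carrier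
  projective = record { dim = 2 ; equations = (3 , equation) ∷ [] }

record EllipticCurve {c ℓ} (k : Field c ℓ) : Set (c ⊔ ℓ) where
  field
    weierstrass : WeierstrassCurve k
  open WeierstrassCurve weierstrass public
  field
    Δ≉0 : ¬ (Field._≈_ k Δ (Field.0# k))

module EllipticGeometry {c ℓ c′ ℓ′} {k : Field c ℓ} {K : Field c′ ℓ′}
                        (closure : AlgebraicClosure k K) (E : EllipticCurve k) where
  open Field K
  open FieldProperties K
  open Geometry K
  open AlgebraicClosure closure
  private module E = EllipticCurve E

  Ē : ProjectiveSet Carrier
  Ē = baseChange ι E.projective

  open Setoid (Points Ē) public using () renaming (_≈_ to _≋_)

  O : Point Ē
  O = record
    { coord   = o
    ; nonzero = 1F , 1≉0
    ; on      = eval-o (mapForm ι E.equation) (inj₂ _ ∷ inj₁ _ ∷ inj₂ _ ∷ inj₁ _ ∷ inj₁ _ ∷ inj₁ _ ∷ inj₂ _ ∷ []) ∷ []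
    }
    where
    o : Vector Carrier 3
    o = 0# Vector.∷ 1# Vector.∷ 0# Vector.∷ Vector.[]

    eval-o : ∀ {d} (f : Form Carrier 3 d) →
             All (λ (_ , e , _) → NonZero (e 0F) ⊎ NonZero (e 2F)) f → eval f o ≈ 0#
    eval-o []                []       = refl
    eval-o ((a , e , _) ∷ f) (h ∷ hs) =
      trans (+-cong (trans (*-congˡ (vanishing h)) (zeroʳ a)) (eval-o f hs)) (+-identityʳ 0#)
      where
      vanishing : NonZero (e 0F) ⊎ NonZero (e 2F) → product (λ i → o i ^ e i) ≈ 0#
      vanishing (inj₁ h) = trans (*-congʳ (0^n≈0 (e 0F) {{h}})) (zeroˡ _)
      vanishing (inj₂ h) = trans (*-congˡ (trans (*-congˡ (trans (*-congʳ (0^n≈0 (e 2F) {{h}})) (zeroˡ _)))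
                                                 (zeroʳ _))) (zeroʳ _)

  -- (X/Z , Y/Z) for [X : Y : Z] with Z ≉ 0, and nothing for the point O.
  affine : Point Ē → Maybe (Carrier × Carrier)
  affine P with coord P 2F ≟ 0#
  ... | yes _ = nothing
  ... | no  _ = just (coord P 0F / coord P 2F , coord P 1F / coord P 2F)

  -- The chord-tangent group law in affine coordinates; defined on arbitrary pairs,
  -- but meaningful only for points of the curve.
  infixl 6 _⊕_
  _⊕_ : Maybe (Carrier × Carrier) → Maybe (Carrier × Carrier) → Maybe (Carrier × Carrier)
  nothing          ⊕ Q                = Q
  P@(just _)       ⊕ nothing          = P
  (just (x₁ , y₁)) ⊕ (just (x₂ , y₂)) = add
    where
    a₁ = ι E.a₁
    a₂ = ι E.a₂
    a₃ = ι E.a₃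
    a₄ = ι E.a₄

    line : Carrier → Maybe (Carrier × Carrier)
    line s = just (x₃ , - ((s + a₁) * x₃) + - (y₁ + - (s * x₁)) + - a₃)
      where x₃ = s ^ 2 + a₁ * s + - a₂ + - x₁ + - x₂

    add : Maybe (Carrier × Carrier)
    add with x₁ ≟ x₂ | (y₁ + y₂ + a₁ * x₂ + a₃) ≟ 0#
    ... | no  _ | _     = line ((y₂ + - y₁) / (x₂ + - x₁))
    ... | yes _ | yes _ = nothing
    ... | yes _ | no  _ = line ((3 · (x₁ ^ 2) + 2 · (a₂ * x₁) + a₄ + - (a₁ * y₁))
                                / (2 · y₁ + a₁ * x₁ + a₃))

  _≈ₐ_ : Maybe (Carrier × Carrier) → Maybe (Carrier × Carrier) → Set (c′ ⊔ ℓ′)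
  _≈ₐ_ = Maybe.Pointwise (Product.Pointwise _≈_ _≈_)

  -- γ(P) = u(P) + a with u an automorphism of (E , O).
  record LinearPart (γ : Morphism Ē Ē) : Set (c′ ⊔ ℓ′) where
    field
      u             : Morphism Ē Ē
      automorphism  : IsAutomorphism u
      fixes-O       : u ⟨$⟩ O ≋ O
      a             : Point Ē
      decomposition : ∀ P → affine (γ ⟨$⟩ P) ≈ₐ (affine (u ⟨$⟩ P) ⊕ affine a)

  record FaithfulAction {g ℓg} (Λ : Group g ℓg) : Set (g ⊔ ℓg ⊔ c′ ⊔ ℓ′) where
    private module Λ = Group Λ
    field
      act      : Λ.Carrier → Morphism Ē Ē
      act-cong : ∀ {γ η} → γ Λ.≈ η → ∀ P → act γ ⟨$⟩ P ≋ act η ⟨$⟩ P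
      act-ε    : ∀ P → act Λ.ε ⟨$⟩ P ≋ P
      act-∙    : ∀ γ η P → act (γ Λ.∙ η) ⟨$⟩ P ≋ act γ ⟨$⟩ (act η ⟨$⟩ P)
      faithful : ∀ γ → (∀ P → act γ ⟨$⟩ P ≋ P) → γ Λ.≈ Λ.ε

    NontrivialLinearParts : Set (g ⊔ c′ ⊔ ℓ′)
    NontrivialLinearParts =
      ∃ λ γ → Σ (LinearPart (act γ)) λ L → ¬ (∀ P → LinearPart.u L ⟨$⟩ P ≋ P)

    -- The quotient by Λ: the universal Λ-invariant morphism, here moreover defined
    -- over k and with the Λ-orbits as geometric fibres.
    record Quotient : Set (lsuc c′ ⊔ ℓ′ ⊔ c ⊔ g) where
      field
        Y          : ProjectiveSet (Field.Carrier k)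

      Ȳ : ProjectiveSet Carrier
      Ȳ = baseChange ι Y

      open Setoid (Points Ȳ) public using () renaming (_≈_ to _≈Y_)

      field
        π          : MorphismOver ι Ē Ȳ
        invariant  : ∀ γ P → (π ⟨$⟩ (act γ ⟨$⟩ P)) ≈Y (π ⟨$⟩ P)
        surjective : ∀ Q → ∃ λ P → (π ⟨$⟩ P) ≈Y Q
        orbit      : ∀ P R → (π ⟨$⟩ P) ≈Y (π ⟨$⟩ R) → ∃ λ γ → act γ ⟨$⟩ P ≋ R
        -- The factorisation is unique since π is surjective.
        universal  : ∀ Z (f : Morphism Ē Z) →
                     let open Setoid (Points Z) using () renaming (_≈_ to _≈Z_) in
                     (∀ γ P → (f ⟨$⟩ (act γ ⟨$⟩ P)) ≈Z (f ⟨$⟩ P)) →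
                     ∃ λ (h : Morphism Ȳ Z) → ∀ P → (h ⟨$⟩ (π ⟨$⟩ P)) ≈Z (f ⟨$⟩ P)

  module FrobeniusAction {p r} (finite : IsFiniteField k p r)
                         {g ℓg} {Λ : Group g ℓg} (action : FaithfulAction Λ) where
    open FaithfulAction action
    open Inverse (FrobeniusOnPoints.𝓕 finite closure E.projective)
      public using () renaming (to to 𝓕; from to 𝓕⁻¹)
    private module Λ = Group Λ

    -- η acts as the 𝓕-conjugate of γ.
    _IsConjugateOf_ : Λ.Carrier → Λ.Carrier → Set (c′ ⊔ ℓ′)
    η IsConjugateOf γ = ∀ P → act η ⟨$⟩ P ≋ 𝓕 (act γ ⟨$⟩ 𝓕⁻¹ P)

    Stable : Set (g ⊔ c′ ⊔ ℓ′)
    Stable = (∀ γ → ∃ λ η → η IsConjugateOf γ) × (∀ η → ∃ λ γ → η IsConjugateOf γ)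

    𝒮 : Λ.Carrier → Point Ē → Set (c′ ⊔ ℓ′)
    𝒮 γ P = 𝓕 P ≋ act γ ⟨$⟩ P

    Stab : Point Ē → Λ.Carrier → Set (c′ ⊔ ℓ′)
    Stab P γ = act γ ⟨$⟩ P ≋ P

------------------------------------------------------------------------
-- Twisted conjugacy

module Twisted {g ℓ} (Λ : Group g ℓ) (ϑ : Group.Carrier Λ → Group.Carrier Λ) where
  open Group Λ

  _∼ϑ_ : Carrier → Carrier → Set (g ⊔ ℓ)
  γ ∼ϑ η = ∃ λ h → η ≈ ϑ h ∙ γ ∙ h ⁻¹

  -- A complete set of representatives, listed without repetition.
  Representatives : ∀ {t} → Vector Carrier t → Set (g ⊔ ℓ)
  Representatives ρ = ∀ γ → ∃! _≡_ λ i → ρ i ∼ϑ γ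

-- Since π is defined over k and Q is rational, 𝓕 preserves the fibre over Q, on which Λ acts
-- transitively.  Hence {γ : 𝓕 R = γ R} is the set of γ carrying R to 𝓕 R, a coset of a conjugate
-- of the stabiliser of P.  Counting the pairs (γ , R) with 𝓕 R = γ R along the fibre, and the
-- pairs (γ , R) with γ P = R likewise, gives ∑ m = |Λ|.  Finally 𝓕 ∘ h = ϑ(h) ∘ 𝓕, so that
-- R ↦ h R carries 𝒮 γ onto 𝒮 (ϑ(h) γ h⁻¹).

module Submission where

open import Defs
open import Algebra.Bundles using (Group)
open import Algebra.Morphism.Structures using (module GroupMorphisms)
open import Data.Nat.Base using (ℕ; _*_)
open import Data.Product using (∃; _×_)
open import Data.Vec.Functional using (Vector)
open import Function.Bundles using (Inverse)
open import Relation.Binary.PropositionalEquality using (_≡_)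

import Algebra.Properties.CommutativeMonoid.Sum as MonoidSum
import Algebra.Properties.Group as GroupProperties
import Algebra.Properties.Semiring.Sum as SemiringSum
open import Data.Fin.Base as Fin using (Fin; zero; suc)
open import Data.Fin.Permutation using (↔⇒≡)
import Data.Fin.Properties as Fin
open import Data.Nat.Base using (zero; suc; _+_; z≤n; s≤s)
import Data.Nat.Properties as ℕ
open import Data.Product using (Σ; ∃!; _,_; proj₁; proj₂)
open import Function.Base using (_∘_; id)
open import Function.Bundles using (Bijection)
import Function.Construct.Composition as Composition
import Function.Construct.Symmetry as Symmetry
open import Function.Properties.Bijection using (Bijection⇒Inverse)
open import Function.Properties.Inverse using (Inverse⇒Injection)
open import Level using (_⊔_)
open import Relation.Binary.Bundles using (Setoid)
import Relation.Binary.Definitions as Binary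
import Relation.Binary.PropositionalEquality as ≡
import Relation.Binary.Reasoning.Setoid as SetoidReasoning
open import Relation.Nullary using (¬_; Dec; yes; no; contradiction)
open import Relation.Nullary.Decidable using (map′; via-injection; _→-dec_; _×-dec_; ¬?)
open import Relation.Unary using (Decidable)

open MonoidSum ℕ.+-0-commutativeMonoid using (∑-comm; sum-cong-≗)
open SemiringSum ℕ.+-*-semiring using (*-distribʳ-sum)

-- Finite cardinalities

-- Equality in a `subsetoid` ignores the membership proofs, so the laws of `I` carry over unchanged.
restrict : ∀ {a ℓ₁ b ℓ₂ p q} {A : Setoid a ℓ₁} {B : Setoid b ℓ₂}
           {P : Setoid.Carrier A → Set p} {Q : Setoid.Carrier B → Set q} (I : Inverse A B) →
           (∀ x → P x → Q (Inverse.to I x)) → (∀ y → Q y → P (Inverse.from I y)) →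
           Inverse (subsetoid A P) (subsetoid B Q)
restrict I f g = record
  { to        = λ (x , p) → to x , f x p
  ; from      = λ (y , q) → from y , g y q
  ; to-cong   = to-cong
  ; from-cong = from-cong
  ; inverse   = inverseˡ , inverseʳ
  }
  where open Inverse I

subsetoid-assoc : ∀ {a ℓ p q} (S : Setoid a ℓ) (P : Setoid.Carrier S → Set p) (Q : Setoid.Carrier S → Set q) →
                  Inverse (subsetoid (subsetoid S P) (Q ∘ proj₁)) (subsetoid S (λ x → Q x × P x))
subsetoid-assoc S P Q = record
  { to        = λ ((x , p) , q) → x , q , p
  ; from      = λ (x , q , p) → (x , p) , q
  ; to-cong   = id
  ; from-cong = id
  ; inverse   = id , id
  }

size-transport : ∀ {a ℓ₁ b ℓ₂} {A : Setoid a ℓ₁} {B : Setoid b ℓ₂} {n} →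
                 Inverse A B → HasSize A n → HasSize B n
size-transport I size = Composition.inverse size I

size-unique : ∀ {a ℓ} {S : Setoid a ℓ} {m n} → HasSize S m → HasSize S n → m ≡ n
size-unique size₁ size₂ = ↔⇒≡ (Composition.inverse size₁ (Symmetry.inverse size₂))

-- The Iverson bracket: cardinalities become sums in `ℕ`, and double counting becomes an interchange
-- of sums.
[_] : ∀ {a} {A : Set a} → Dec A → ℕ
[ yes _ ] = 1
[ no  _ ] = 0

-- Where the condition fails both products are 0, so the factors need to agree only under the
-- condition.
[]-*-cong : ∀ {a} {A : Set a} (A? : Dec A) {m n} → (A → m ≡ n) → [ A? ] * m ≡ [ A? ] * n
[]-*-cong (yes a) m≡n = ≡.cong (_+ 0) (m≡n a)
[]-*-cong (no  _) _   = ≡.refl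

count : ∀ {n p} {P : Fin n → Set p} → Decidable P → ℕ
count P? = ∑ (λ i → [ P? i ])

∑-1 : ∀ n → ∑ {n} (λ _ → 1) ≡ n
∑-1 zero    = ≡.refl
∑-1 (suc n) = ≡.cong suc (∑-1 n)

-- Induction on `n`: the enumeration of the tail is shifted by `suc`, and `zero` is put in front of
-- it exactly when `P zero` holds.
Fin-subset-size : ∀ {n p} {P : Fin n → Set p} (P? : Decidable P) →
                  HasSize (subsetoid (≡.setoid (Fin n)) P) (count P?)
Fin-subset-size {zero}          P? = record
  { to        = λ ()
  ; from      = λ ()
  ; to-cong   = λ { {()} }
  ; from-cong = λ { {()} }
  ; inverse   = (λ { {()} }) , (λ { {()} })
  }
Fin-subset-size {suc n} {P = P} P? with P? zero | Fin-subset-size (P? ∘ suc)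
... | no ¬p₀ | I = record
  { to        = λ i → suc (proj₁ (I.to i)) , proj₂ (I.to i)
  ; from      = from
  ; to-cong   = ≡.cong (λ i → suc (proj₁ (I.to i)))
  ; from-cong = λ {x} {y} → from-cong x y
  ; inverse   = (λ {x} {y} → inverseˡ x y) , (λ {i} {x} → inverseʳ i x)
  }
  where
  module I = Inverse I
  from : Σ (Fin (suc n)) P → Fin (count (P? ∘ suc))
  from (zero  , p) = contradiction p ¬p₀
  from (suc i , p) = I.from (i , p)
  from-cong : ∀ x y → proj₁ x ≡ proj₁ y → from x ≡ from y
  from-cong (zero  , p) _             _      = contradiction p ¬p₀
  from-cong (suc i , p) (.(suc i) , _) ≡.refl = I.from-cong ≡.refl
  inverseˡ : ∀ x y → y ≡ from x → suc (proj₁ (I.to y)) ≡ proj₁ x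
  inverseˡ (zero  , p) _ _ = contradiction p ¬p₀
  inverseˡ (suc i , p) _ e = ≡.cong suc (I.inverseˡ e)
  inverseʳ : ∀ i x → proj₁ x ≡ suc (proj₁ (I.to i)) → from x ≡ i
  inverseʳ i (.(suc _) , p) ≡.refl = I.inverseʳ ≡.refl
... | yes p₀ | I = record
  { to        = to
  ; from      = from
  ; to-cong   = ≡.cong (λ i → proj₁ (to i))
  ; from-cong = λ {x} {y} → from-cong x y
  ; inverse   = (λ {x} {y} → inverseˡ x y) , (λ {i} {x} → inverseʳ i x)
  }
  where
  module I = Inverse I
  to : Fin (suc (count (P? ∘ suc))) → Σ (Fin (suc n)) P
  to zero    = zero , p₀
  to (suc i) = suc (proj₁ (I.to i)) , proj₂ (I.to i)
  from : Σ (Fin (suc n)) P → Fin (suc (count (P? ∘ suc)))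
  from (zero  , p) = zero
  from (suc i , p) = suc (I.from (i , p))
  from-cong : ∀ x y → proj₁ x ≡ proj₁ y → from x ≡ from y
  from-cong (zero  , p) (.zero    , _) ≡.refl = ≡.refl
  from-cong (suc i , p) (.(suc i) , _) ≡.refl = ≡.cong suc (I.from-cong ≡.refl)
  inverseˡ : ∀ x y → y ≡ from x → proj₁ (to y) ≡ proj₁ x
  inverseˡ (zero  , p) _ ≡.refl = ≡.refl
  inverseˡ (suc i , p) _ ≡.refl = ≡.cong suc (I.inverseˡ ≡.refl)
  inverseʳ : ∀ i x → proj₁ x ≡ proj₁ (to i) → from x ≡ i
  inverseʳ zero    (.zero    , p) ≡.refl = ≡.refl
  inverseʳ (suc i) (.(suc _) , p) ≡.refl = ≡.cong suc (I.inverseʳ ≡.refl)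

-- The subset is pulled back to indices. That `P` respects equality is what moves membership from
-- `y` to its enumerated copy `to (from y)`.
subset-size : ∀ {a ℓ p} {S : Setoid a ℓ} {n} (size : HasSize S n)
              {P : Setoid.Carrier S → Set p} (P? : Decidable P) →
              (∀ {x y} → Setoid._≈_ S x y → P x → P y) →
              HasSize (subsetoid S P) (count (P? ∘ Inverse.to size))
subset-size {S = S} size P? P-resp = size-transport
  (restrict size (λ _ p → p) (λ y → P-resp (Setoid.sym S (Inverse.strictlyInverseˡ size y))))
  (Fin-subset-size (P? ∘ Inverse.to size))

-- Uniqueness makes the subset a one-element setoid, whatever the proofs of `P` are, and two
-- enumerations of the same setoid have equal length.
count-∃! : ∀ {n p} {P : Fin n → Set p} (P? : Decidable P) → ∃! _≡_ P → count P? ≡ 1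
count-∃! {P = P} P? (i , p , unique) = size-unique (Fin-subset-size P?) singleton
  where
  singleton : HasSize (subsetoid (≡.setoid _) P) 1
  singleton = record
    { to        = λ _ → i , p
    ; from      = λ _ → zero
    ; to-cong   = λ _ → ≡.refl
    ; from-cong = λ _ → ≡.refl
    ; inverse   = (λ {(_ , q)} _ → unique q) , λ { {zero} _ → ≡.refl }
    }

least : ∀ {n p} {P : Fin n → Set p} → Decidable P → ∃ P → ∃ λ i → P i × ∀ j → P j → i Fin.≤ j
least {suc n} P? ∃P with P? zero
... | yes p₀ = zero , p₀ , λ _ _ → z≤n
... | no ¬p₀ with ∃P
...   | zero  , p = contradiction p ¬p₀
...   | suc i , p with least (P? ∘ suc) (i , p)
...     | j , q , j≤ = suc j , q , λ { zero p₀ → contradiction p₀ ¬p₀ ; (suc l) p → s≤s (j≤ l p) }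

-- The elements of S correspond to the first indices at which f takes each value.
image-size : ∀ {a ℓ n} {S : Setoid a ℓ} → Binary.Decidable (Setoid._≈_ S) →
             (f : Fin n → Setoid.Carrier S) → (∀ x → ∃ λ i → Setoid._≈_ S (f i) x) → ∃ (HasSize S)
image-size {n = n} {S} _≟_ f surjective =
  _ , size-transport (Bijection⇒Inverse bijection) (Fin-subset-size First?)
  where
  open Setoid S
  First : Fin n → Set _
  First i = ∀ j → f j ≈ f i → i Fin.≤ j
  First? : Decidable First
  First? i = Fin.all? λ j → (f j ≟ f i) →-dec (i Fin.≤? j)
  first : ∀ x → ∃ λ i → f i ≈ x × First i
  first x with least (λ i → f i ≟ x) (surjective x)
  ... | i , fi≈x , i≤ = i , fi≈x , λ j fj≈fi → i≤ j (trans fj≈fi fi≈x)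
  bijection : Bijection (subsetoid (≡.setoid (Fin n)) First) S
  bijection = record
    { to        = f ∘ proj₁
    ; cong      = λ e → reflexive (≡.cong f e)
    ; bijective = (λ {(i , i-first)} {(j , j-first)} fi≈fj →
                     Fin.≤-antisym (i-first j (sym fi≈fj)) (j-first i fi≈fj))
                , λ x → let i , fi≈x , i-first = first x in
                        (i , i-first) , λ { ≡.refl → fi≈x }
    }

-- Twisted fixed points of a finite group action

record Action {g ℓg x ℓx} (Λ : Group g ℓg) (X : Setoid x ℓx) : Set (g ⊔ ℓg ⊔ x ⊔ ℓx) where
  open Group Λ using (_∙_; ε) renaming (Carrier to G; _≈_ to _≈ᴳ_)
  open Setoid X
  infixr 7 _•_
  field
    _•_    : G → Carrier → Carrier
    •-cong : ∀ {γ η P R} → γ ≈ᴳ η → P ≈ R → γ • P ≈ η • R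
    •-ε    : ∀ P → ε • P ≈ P
    •-∙    : ∀ γ η P → (γ ∙ η) • P ≈ γ • η • P

module ActionProperties {g ℓg x ℓx} {Λ : Group g ℓg} {X : Setoid x ℓx} (action : Action Λ X) where
  open Group Λ using (_∙_; ε; _⁻¹; inverseˡ; inverseʳ; ∙-congˡ; ∙-congʳ)
    renaming (Carrier to G; _≈_ to _≈ᴳ_; setoid to setoidᴳ; refl to reflᴳ; trans to transᴳ)
  open GroupProperties Λ using (\\-leftDividesˡ; \\-leftDividesʳ; //-rightDividesˡ; //-rightDividesʳ)
  open Setoid X
  open Action action
  open SetoidReasoning X

  •-congˡ : ∀ γ {P R} → P ≈ R → γ • P ≈ γ • R
  •-congˡ γ = •-cong reflᴳ

  •-congʳ : ∀ {γ η} P → γ ≈ᴳ η → γ • P ≈ η • P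
  •-congʳ P γ≈η = •-cong γ≈η refl

  •-cancel : ∀ {γ η} P → γ ∙ η ≈ᴳ ε → γ • η • P ≈ P
  •-cancel {γ} {η} P γη≈ε = trans (sym (•-∙ γ η P)) (trans (•-congʳ P γη≈ε) (•-ε P))

  ⁻¹-• : ∀ {γ P R} → γ • P ≈ R → γ ⁻¹ • R ≈ P
  ⁻¹-• {γ} {P} γP≈R = trans (•-congˡ (γ ⁻¹) (sym γP≈R)) (•-cancel P (inverseˡ γ))

  translation : G → Inverse X X
  translation γ = record
    { to        = γ •_
    ; from      = γ ⁻¹ •_
    ; to-cong   = •-congˡ γ
    ; from-cong = •-congˡ (γ ⁻¹)
    ; inverse   = (λ {P} e → trans (•-congˡ γ e) (•-cancel P (inverseʳ γ)))
                , (λ {P} e → trans (•-congˡ (γ ⁻¹) e) (•-cancel P (inverseˡ γ)))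
    }

  -- The transporter from `R` to `R′` is the two-sided translate of the stabiliser of `P` by `ε` on
  -- the left and `δ ⁻¹` on the right. Here `ε` is an element carrying `P` to `R′`, not the
  -- identity.
  stabiliser↔transporter : ∀ {P R R′ δ ε} → δ • P ≈ R → ε • P ≈ R′ →
    Inverse (subsetoid setoidᴳ (λ γ → γ • P ≈ P)) (subsetoid setoidᴳ (λ γ → γ • R ≈ R′))
  stabiliser↔transporter {P} {R} {R′} {δ} {ε} δP≈R εP≈R′ = restrict shift
    (λ σ σP≈P → begin
      (ε ∙ σ ∙ δ ⁻¹) • R   ≈⟨ •-∙ (ε ∙ σ) (δ ⁻¹) R ⟩
      (ε ∙ σ) • δ ⁻¹ • R   ≈⟨ •-congˡ (ε ∙ σ) (⁻¹-• δP≈R) ⟩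
      (ε ∙ σ) • P          ≈⟨ •-∙ ε σ P ⟩
      ε • σ • P            ≈⟨ •-congˡ ε σP≈P ⟩
      ε • P                ≈⟨ εP≈R′ ⟩
      R′                   ∎)
    (λ γ γR≈R′ → begin
      (ε ⁻¹ ∙ (γ ∙ δ)) • P  ≈⟨ •-∙ (ε ⁻¹) (γ ∙ δ) P ⟩
      ε ⁻¹ • (γ ∙ δ) • P    ≈⟨ •-congˡ (ε ⁻¹) (•-∙ γ δ P) ⟩
      ε ⁻¹ • γ • δ • P      ≈⟨ •-congˡ (ε ⁻¹) (•-congˡ γ δP≈R) ⟩
      ε ⁻¹ • γ • R          ≈⟨ •-congˡ (ε ⁻¹) γR≈R′ ⟩
      ε ⁻¹ • R′             ≈⟨ ⁻¹-• εP≈R′ ⟩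
      P                     ∎)
    where
    shift : Inverse setoidᴳ setoidᴳ
    shift = record
      { to        = λ σ → ε ∙ σ ∙ δ ⁻¹
      ; from      = λ γ → ε ⁻¹ ∙ (γ ∙ δ)
      ; to-cong   = λ e → ∙-congʳ (∙-congˡ e)
      ; from-cong = λ e → ∙-congˡ (∙-congʳ e)
      ; inverse   = (λ {γ} e → transᴳ (∙-congʳ (transᴳ (∙-congˡ e) (\\-leftDividesˡ ε (γ ∙ δ)))) (//-rightDividesʳ δ γ))
                  , (λ {σ} e → transᴳ (∙-congˡ (transᴳ (∙-congʳ e) (//-rightDividesˡ δ (ε ∙ σ)))) (\\-leftDividesʳ ε σ))
      }

-- Twisted conjugacy classes in a finite group

module TwistedProperties {g ℓg} {Λ : Group g ℓg} {n} (size : HasSize (Group.setoid Λ) n)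
  {ϑ : Group.Carrier Λ → Group.Carrier Λ}
  (isIsomorphism : GroupMorphisms.IsGroupIsomorphism (Group.rawGroup Λ) (Group.rawGroup Λ) ϑ) where
  open Group Λ
  open Twisted Λ ϑ
  open GroupMorphisms.IsGroupIsomorphism isIsomorphism using (⟦⟧-cong; ⁻¹-homo)
  open GroupProperties Λ using (\\-leftDividesʳ; //-rightDividesˡ; ⁻¹-involutive)
  open Inverse size using (to; from; strictlyInverseˡ)

  _≟_ : Binary.Decidable _≈_
  _≟_ = via-injection (Inverse⇒Injection (Symmetry.inverse size)) Fin._≟_

  -- A finite search for the conjugating element; any witness `h` may be replaced by its enumerated
  -- copy, since `ϑ`, product and inverse respect equality.
  _∼ϑ?_ : Binary.Decidable _∼ϑ_
  γ ∼ϑ? η = map′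
    (λ (i , e) → to i , e)
    (λ (h , e) → from h , trans e (sym
      (∙-cong (∙-congʳ (⟦⟧-cong (strictlyInverseˡ h))) (⁻¹-cong (strictlyInverseˡ h)))))
    (Fin.any? λ i → η ≟ (ϑ (to i) ∙ γ ∙ to i ⁻¹))

  ∼ϑ-respʳ : ∀ {γ η η′} → η ≈ η′ → γ ∼ϑ η → γ ∼ϑ η′
  ∼ϑ-respʳ η≈η′ (h , e) = h , trans (sym η≈η′) e

  -- Solving for `γ`. The witness `h ⁻¹` is kept explicit because translation by this very element
  -- will invert translation by `h` on twisted fixed points.
  ∼ϑ-sym : ∀ {γ η h} → η ≈ ϑ h ∙ γ ∙ h ⁻¹ → γ ≈ ϑ (h ⁻¹) ∙ η ∙ h ⁻¹ ⁻¹
  ∼ϑ-sym {γ} {η} {h} e = begin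
    γ                              ≈⟨ \\-leftDividesʳ (ϑ h) γ ⟨
    ϑ h ⁻¹ ∙ (ϑ h ∙ γ)             ≈⟨ ∙-congˡ (//-rightDividesˡ h (ϑ h ∙ γ)) ⟨
    ϑ h ⁻¹ ∙ (ϑ h ∙ γ ∙ h ⁻¹ ∙ h)  ≈⟨ ∙-congˡ (∙-congʳ e) ⟨
    ϑ h ⁻¹ ∙ (η ∙ h)               ≈⟨ assoc _ η h ⟨
    ϑ h ⁻¹ ∙ η ∙ h                 ≈⟨ ∙-cong (∙-congʳ (⁻¹-homo h)) (⁻¹-involutive h) ⟨
    ϑ (h ⁻¹) ∙ η ∙ h ⁻¹ ⁻¹         ∎
    where open SetoidReasoning setoid

  class-size : ∀ γ → HasSize (subsetoid setoid (γ ∼ϑ_)) (count (λ i → γ ∼ϑ? to i))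
  class-size γ = subset-size size (γ ∼ϑ?_) ∼ϑ-respʳ

  -- Double counting of the pairs consisting of a representative and a group element in its class,
  -- each pair weighted by `w`.
  sum-over-classes : (w : Carrier → ℕ) → (∀ γ η → γ ∼ϑ η → w γ ≡ w η) →
                     ∀ {t} (ρ : Vector Carrier t) → Representatives ρ →
                     ∑ (λ k → count (λ i → ρ k ∼ϑ? to i) * w (ρ k)) ≡ ∑ (λ i → w (to i))
  sum-over-classes w w-const {t} ρ reps = begin
    ∑ (λ k → count (λ i → ρ k ∼ϑ? to i) * w (ρ k))
      ≡⟨ sum-cong-≗ {t} (λ k → *-distribʳ-sum (w (ρ k)) (λ i → [ ρ k ∼ϑ? to i ])) ⟩
    ∑ (λ k → ∑ (λ i → [ ρ k ∼ϑ? to i ] * w (ρ k)))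
      ≡⟨ ∑-comm {t} {n} (λ k i → [ ρ k ∼ϑ? to i ] * w (ρ k)) ⟩
    ∑ (λ i → ∑ (λ k → [ ρ k ∼ϑ? to i ] * w (ρ k)))
      -- The weight moves from the representative to the element, which is allowed because a nonzero
      -- bracket puts both in one class.
      ≡⟨ sum-cong-≗ {n} (λ i → sum-cong-≗ {t} λ k → []-*-cong (ρ k ∼ϑ? to i) (w-const (ρ k) (to i))) ⟩
    ∑ (λ i → ∑ (λ k → [ ρ k ∼ϑ? to i ] * w (to i)))
      ≡⟨ sum-cong-≗ {n} (λ i → *-distribʳ-sum (w (to i)) (λ k → [ ρ k ∼ϑ? to i ])) ⟨
    ∑ (λ i → count (λ k → ρ k ∼ϑ? to i) * w (to i))
      -- Completeness and non-repetition of `ρ`: each element lies in the class of exactly one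
      -- representative.
      ≡⟨ sum-cong-≗ {n} (λ i → ≡.cong (_* w (to i)) (count-∃! (λ k → ρ k ∼ϑ? to i) (reps (to i)))) ⟩
    ∑ (λ i → 1 * w (to i))
      ≡⟨ sum-cong-≗ {n} (λ i → ℕ.*-identityˡ (w (to i))) ⟩
    ∑ (λ i → w (to i))
      ∎
    where open ≡.≡-Reasoning

-- Counting twisted fixed points along one orbit

module TwistedFixedPoints {g ℓg x ℓx} {Λ : Group g ℓg} {n} (size : HasSize (Group.setoid Λ) n)
  {X : Setoid x ℓx} (action : Action Λ X) {ϑ : Group.Carrier Λ → Group.Carrier Λ}
  (isIsomorphism : GroupMorphisms.IsGroupIsomorphism (Group.rawGroup Λ) (Group.rawGroup Λ) ϑ)
  where
  open Setoid X
  open Action action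
  open Group Λ using (_∙_; _⁻¹)
    renaming (Carrier to G; _≈_ to _≈ᴳ_; setoid to setoidᴳ; sym to symᴳ)
  open ActionProperties action
  open Twisted Λ ϑ using (_∼ϑ_)
  open TwistedProperties {Λ = Λ} size isIsomorphism using (∼ϑ-sym)
  open Inverse size using (to; from; strictlyInverseˡ)

  -- An abstract model of the geometric fibre over a rational point: `Orbit` is a single orbit, and
  -- `F`, in the role of Frobenius, preserves it and commutes with the action up to `ϑ`.
  module Fibre
    (_≟_ : Binary.Decidable _≈_)
    (F : Carrier → Carrier)
    (F-cong : ∀ {P R} → P ≈ R → F P ≈ F R)
    (F-• : ∀ γ P → F (γ • P) ≈ ϑ γ • F P)
    {c} (Orbit : Carrier → Set c)
    (Orbit-• : ∀ γ {P} → Orbit P → Orbit (γ • P))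
    (Orbit-F : ∀ {P} → Orbit P → Orbit (F P))
    (transitive : ∀ {P R} → Orbit P → Orbit R → ∃ λ γ → γ • P ≈ R)
    {P : Carrier} (P∈ : Orbit P)
    where

    s : ℕ
    s = count (λ i → (to i • P) ≟ P)

    transporter-size : ∀ R R′ → HasSize (subsetoid setoidᴳ (λ γ → γ • R ≈ R′)) (count (λ i → (to i • R) ≟ R′))
    transporter-size R R′ = subset-size size (λ γ → (γ • R) ≟ R′) (λ γ≈η → trans (•-congʳ R (symᴳ γ≈η)))

    transporter-size-s : ∀ {R R′} → Orbit R → Orbit R′ → HasSize (subsetoid setoidᴳ (λ γ → γ • R ≈ R′)) s
    transporter-size-s R∈ R′∈ = size-transport
      (stabiliser↔transporter (proj₂ (transitive P∈ R∈)) (proj₂ (transitive P∈ R′∈)))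
      (transporter-size P P)

    count-transporter : ∀ {R R′} → Orbit R → Orbit R′ → count (λ i → (to i • R) ≟ R′) ≡ s
    count-transporter {R} {R′} R∈ R′∈ = size-unique (transporter-size R R′) (transporter-size-s R∈ R′∈)

    orbit : Setoid _ _
    orbit = subsetoid X Orbit

    -- `X` itself may be infinite; the orbit is finite as the image of the enumerated group under
    -- its action on `P`.
    orbit-size : ∃ (HasSize orbit)
    orbit-size = image-size (λ (R , _) (R′ , _) → R ≟ R′) (λ i → to i • P , Orbit-• (to i) P∈)
      (λ (R , R∈) → let γ , γP≈R = transitive P∈ R∈ in
        from γ , trans (•-congʳ P (strictlyInverseˡ γ)) γP≈R)

    ∣orbit∣ : ℕ
    ∣orbit∣ = proj₁ orbit-size

    private module O = Inverse (proj₂ orbit-size)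

    pt : Fin ∣orbit∣ → Carrier
    pt j = proj₁ (O.to j)

    pt∈ : ∀ j → Orbit (pt j)
    pt∈ j = proj₂ (O.to j)

    -- Counts the pairs of a group element and an orbit point to which it carries `P`: each point
    -- receives `s` elements, and each element carries `P` to exactly one point. The product of
    -- orbit size and `s` is left as a constant sum, the form in which `∑m≡n` meets it.
    orbit-stabiliser : ∑ {∣orbit∣} (λ _ → s) ≡ n
    orbit-stabiliser = begin
      ∑ {∣orbit∣} (λ _ → s)
        ≡⟨ sum-cong-≗ {∣orbit∣} (λ j → count-transporter P∈ (pt∈ j)) ⟨
      ∑ {∣orbit∣} (λ j → count (λ i → (to i • P) ≟ pt j))
        ≡⟨ ∑-comm {∣orbit∣} {n} (λ j i → [ (to i • P) ≟ pt j ]) ⟩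
      ∑ {n} (λ i → count (λ j → (to i • P) ≟ pt j))
        ≡⟨ sum-cong-≗ {n} (λ i → count-∃! (λ j → (to i • P) ≟ pt j) (index i)) ⟩
      ∑ {n} (λ _ → 1)
        ≡⟨ ∑-1 n ⟩
      n ∎
      where
      open ≡.≡-Reasoning
      index : ∀ i → ∃! _≡_ λ j → to i • P ≈ pt j
      index i = O.from R , sym (O.strictlyInverseˡ R) , λ e → O.inverseʳ e
        where R = to i • P , Orbit-• (to i) P∈

    fixed? : ∀ γ → Decidable {A = Fin ∣orbit∣} (λ j → F (pt j) ≈ γ • pt j)
    fixed? γ j = F (pt j) ≟ (γ • pt j)

    -- Counted along the enumeration of the orbit, so that the sum over the group can be
    -- interchanged with it.
    m : G → ℕ
    m γ = count (fixed? γ)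

    fixed-size : ∀ γ → HasSize (subsetoid X (λ R → F R ≈ γ • R × Orbit R)) (m γ)
    fixed-size γ = size-transport (subsetoid-assoc X Orbit (λ R → F R ≈ γ • R))
      (subset-size (proj₂ orbit-size) (λ (R , _) → F R ≟ (γ • R))
        (λ R≈R′ FR≈γR → trans (F-cong (sym R≈R′)) (trans FR≈γR (•-congˡ γ R≈R′))))

    -- These elements form the transporter from `R` to `F R`, and `Orbit-F` keeps `F R` in the
    -- orbit, so the transporter has the size of the stabiliser of `P`.
    fixing-size : ∀ R → Orbit R → HasSize (subsetoid setoidᴳ (λ γ → F R ≈ γ • R)) s
    fixing-size R R∈ = size-transport flip (transporter-size-s R∈ (Orbit-F R∈))
      where
      flip = record
        { to        = λ (γ , e) → γ , sym e
        ; from      = λ (γ , e) → γ , sym e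
        ; to-cong   = id
        ; from-cong = id
        ; inverse   = id , id
        }

    ∑m≡n : ∑ (λ i → m (to i)) ≡ n
    ∑m≡n = begin
      ∑ (λ i → m (to i))
        ≡⟨ ∑-comm {n} {∣orbit∣} (λ i j → [ fixed? (to i) j ]) ⟩
      ∑ {∣orbit∣} (λ j → count (λ i → fixed? (to i) j))
        -- After the interchange, the inner count enumerates the elements `γ` with `F R ≈ γ • R` at
        -- one fixed orbit point, of which there are `s`.
        ≡⟨ sum-cong-≗ {∣orbit∣} (λ j → size-unique
             (subset-size size (λ γ → fixed? γ j) (λ γ≈η e → trans e (•-congʳ (pt j) γ≈η)))
             (fixing-size (pt j) (pt∈ j))) ⟩
      ∑ {∣orbit∣} (λ _ → s)
        ≡⟨ orbit-stabiliser ⟩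
      n ∎
      where open ≡.≡-Reasoning

    -- Moving `F` past `h` produces `ϑ h` on the left, and rewriting `R` as `h ⁻¹ • h • R` produces
    -- `h ⁻¹` on the right: this is the twisted conjugate of `γ`.
    fixed-• : ∀ {γ η h R} → η ≈ᴳ ϑ h ∙ γ ∙ h ⁻¹ → F R ≈ γ • R → F (h • R) ≈ η • h • R
    fixed-• {γ} {η} {h} {R} e FR≈γR = begin
      F (h • R)                     ≈⟨ F-• h R ⟩
      ϑ h • F R                     ≈⟨ •-congˡ (ϑ h) FR≈γR ⟩
      ϑ h • γ • R                   ≈⟨ •-∙ (ϑ h) γ R ⟨
      (ϑ h ∙ γ) • R                 ≈⟨ •-congˡ (ϑ h ∙ γ) (⁻¹-• refl) ⟨
      (ϑ h ∙ γ) • h ⁻¹ • h • R      ≈⟨ •-∙ (ϑ h ∙ γ) (h ⁻¹) (h • R) ⟨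
      (ϑ h ∙ γ ∙ h ⁻¹) • h • R      ≈⟨ •-congʳ (h • R) e ⟨
      η • h • R                     ∎
      where open SetoidReasoning X

    -- Translation by `h` is a bijection between the two sets of twisted fixed points in the orbit;
    -- its inverse is handled by the same lemma applied to `∼ϑ-sym`.
    m-constant : ∀ γ η → γ ∼ϑ η → m γ ≡ m η
    m-constant γ η (h , e) = size-unique (size-transport I (fixed-size γ)) (fixed-size η)
      where
      I = restrict {A = X} {B = X} (translation h)
        (λ R (FR≈γR , R∈) → fixed-• e FR≈γR , Orbit-• h R∈)
        (λ R (FR≈ηR , R∈) → fixed-• (∼ϑ-sym e) FR≈ηR , Orbit-• (h ⁻¹) R∈)

-- Frobenius and morphisms over k

module GeometryProperties {c ℓ} (K : Field c ℓ) where
  open Field K hiding (_*_)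
  private module K = Field K
  open FieldProperties K
  open Geometry K

  ≈⇒∼ : ∀ {n} {x y : Vector Carrier n} → (∀ i → x i ≈ y i) → x ∼ y
  ≈⇒∼ x≈y = 1# , 1≉0 , λ i → trans (sym (x≈y i)) (sym (*-identityˡ _))

  -- At a coordinate where P does not vanish, only one scale factor is possible.
  _∼?_ : ∀ {X} (P R : Point X) → Dec (coord P ∼ coord R)
  P ∼? R = map′ (λ (s≉0 , e) → s , s≉0 , e) scaled (¬? (s ≟ 0#) ×-dec Fin.all? (λ j → y j ≟ (s K.* x j)))
    where
    x = coord P
    y = coord R
    i = proj₁ (nonzero P)
    x⁻¹ = proj₁ (inverse (x i) (proj₂ (nonzero P)))
    xx⁻¹≈1 : x i K.* x⁻¹ ≈ 1#
    xx⁻¹≈1 = proj₂ (inverse (x i) (proj₂ (nonzero P)))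
    s = y i K.* x⁻¹
    scaled : x ∼ y → ¬ (s ≈ 0#) × (∀ j → y j ≈ s K.* x j)
    scaled (t , t≉0 , y≈tx) = (λ s≈0 → t≉0 (trans (sym s≈t) s≈0)) , λ j → trans (y≈tx j) (*-congʳ (sym s≈t))
      where
      s≈t : s ≈ t
      s≈t = trans (*-congʳ (y≈tx i)) (trans (*-assoc t (x i) x⁻¹) (trans (*-congˡ xx⁻¹≈1) (*-identityʳ t)))

module FrobeniusProperties {c ℓ c′ ℓ′} {k : Field c ℓ} {K : Field c′ ℓ′} {p r}
                           (finite : IsFiniteField k p r) (closure : AlgebraicClosure k K) where
  open Field K
  open AlgebraicClosure closure using (ι)
  open Geometry K
  open GeometryProperties K
  open Frobenius finite closure
  private module F X = FrobeniusOnPoints finite closure X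

  -- The q-th power fixes each coordinate of a representative over `k`, and it sends proportional
  -- vectors to proportional vectors.
  𝓕-rational : ∀ {X} (Q : Point (baseChange ι X)) → IsRational ι {baseChange ι X} Q →
               coord (F.to X Q) ∼ coord Q
  𝓕-rational {X} Q (x , ιx∼Q) =
    ∼-trans {y = ι ∘ x} (∼-trans {y = λ i → ι (x i) ^ q}
      (∼-sym {x = λ i → ι (x i) ^ q} (F.to-cong X {x = ι ∘ x} {y = coord Q} ιx∼Q))
      (≈⇒∼ (λ i → ^q-ι (x i))))
      ιx∼Q

  -- Forms with coefficients in `k` take at the Frobenius image of `R` the q-th powers of their
  -- values at `R`. Hence forms not all vanishing at the image do not all vanish at `R`, and one
  -- choice of forms represents `π` at both points.
  𝓕-commutes : ∀ {X Y} (π : MorphismOver ι (baseChange ι X) (baseChange ι Y)) R →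
               coord (π ⟨$⟩ F.to X R) ∼ coord (F.to Y (π ⟨$⟩ R))
  𝓕-commutes {X} {Y} π R with MorphismOver.regular π (F.to X R)
  ... | d , f , (i , value≉0) , represents =
    ∼-trans {y = λ i → eval (mapForm ι (f i)) (coord (F.to X R))}
      (∼-sym {x = λ i → eval (mapForm ι (f i)) (coord (F.to X R))} (represents (F.to X R) (i , value≉0)))
      (∼-trans {y = λ i → eval (mapForm ι (f i)) (coord R) ^ q}
        (≈⇒∼ power)
        (F.to-cong Y {x = λ i → eval (mapForm ι (f i)) (coord R)} {y = coord (π ⟨$⟩ R)}
          (represents R (i , λ e → value≉0 (F.^q≈0⇒ X (power i) e)))))
    where
    power : ∀ i → eval (mapForm ι (f i)) (coord (F.to X R)) ≈ eval (mapForm ι (f i)) (coord R) ^ q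
    power i = F.eval-^q X (f i) (λ _ → refl)

-- The geometric fibre of the quotient map over a rational point

proposition3p4 :
  ∀ {c ℓ c′ ℓ′ g ℓg} {k : Field c ℓ} {K : Field c′ ℓ′} {p r}
    (finite : IsFiniteField k p r) (closure : AlgebraicClosure k K)
    (E : EllipticCurve k) →
    let open Geometry K
        open EllipticGeometry closure E in
  ∀ {Λ : Group g ℓg} {n} (∣Λ∣≡n : HasSize (Group.setoid Λ) n) (action : FaithfulAction Λ) →
    let module Λ = Group Λ
        open FaithfulAction action
        open FrobeniusAction finite action in
    Stable → NontrivialLinearParts →
  ∀ (ϑ : Λ.Carrier → Λ.Carrier) →
    GroupMorphisms.IsGroupIsomorphism Λ.rawGroup Λ.rawGroup ϑ →
    (∀ γ → ϑ γ IsConjugateOf γ) →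
    let open Twisted Λ ϑ in
  ∀ (quotient : Quotient) →
    let open Quotient quotient in
  ∀ (Q : Point Ȳ) → IsRational (AlgebraicClosure.ι closure) {Ȳ} Q →
  ∀ (P : Point Ē) → (π ⟨$⟩ P) ≈Y Q →
  ∃ λ (s : ℕ) → ∃ λ (m : Λ.Carrier → ℕ) → ∃ λ (∣[_]∣ : Λ.Carrier → ℕ) →
    HasSize (subsetoid Λ.setoid (Stab P)) s ×
    (∀ γ → HasSize (subsetoid (Points Ē) (λ R → 𝒮 γ R × (π ⟨$⟩ R) ≈Y Q)) (m γ)) ×
    (∀ γ → HasSize (subsetoid Λ.setoid (γ ∼ϑ_)) ∣[ γ ]∣) ×
    (∀ R → (π ⟨$⟩ R) ≈Y Q → HasSize (subsetoid Λ.setoid (λ γ → 𝒮 γ R)) s) ×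
    ∑ (λ i → m (Inverse.to ∣Λ∣≡n i)) ≡ n ×
    (∀ γ η → γ ∼ϑ η → m γ ≡ m η) ×
    (∀ {t} (ρ : Vector Λ.Carrier t) → Representatives ρ →
      ∑ (λ i → ∣[ ρ i ]∣ * m (ρ i)) ≡ n)
proposition3p4 {K = K} finite closure E {Λ} ∣Λ∣≡n action _ _ ϑ isIsomorphism conjugate quotient Q Q-rational P πP≈Q =
  T.s , T.m , (λ γ → count (λ i → γ ∼ϑ? Inverse.to ∣Λ∣≡n i)) ,
  T.transporter-size P P , T.fixed-size , class-size , T.fixing-size , T.∑m≡n , T.m-constant ,
  λ ρ reps → ≡.trans (sum-over-classes T.m T.m-constant ρ reps) T.∑m≡n
  where
  open Geometry K
  open GeometryProperties K
  open EllipticGeometry closure E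
  open FaithfulAction action
  open Quotient quotient
  open FrobeniusAction finite action
  open TwistedProperties {Λ = Λ} ∣Λ∣≡n isIsomorphism using (_∼ϑ?_; class-size; sum-over-classes)
  open Inverse (FrobeniusOnPoints.𝓕 finite closure (EllipticCurve.projective E)) using (to-cong; strictlyInverseʳ)
  module Ē = Setoid (Points Ē)
  module Ȳ = Setoid (Points Ȳ)
  module FY = FrobeniusOnPoints finite closure Y
  open FrobeniusProperties finite closure

  Λ-action : Action Λ (Points Ē)
  Λ-action = record
    { _•_    = λ γ P → act γ ⟨$⟩ P
    ; •-cong = λ {γ} {η} {P} {R} γ≈η P≈R → Ē.trans {act γ ⟨$⟩ P} {act η ⟨$⟩ P} {act η ⟨$⟩ R}
                 (act-cong γ≈η P) (MorphismOver.cong (act η) {P} {R} P≈R)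
    ; •-ε    = act-ε
    ; •-∙    = act-∙
    }

  -- The conjugation formula for `ϑ γ`, evaluated at `𝓕 R`, where the inner `𝓕⁻¹` cancels.
  𝓕-act : ∀ γ R → 𝓕 (act γ ⟨$⟩ R) ≋ act (ϑ γ) ⟨$⟩ 𝓕 R
  𝓕-act γ R = Ē.sym {act (ϑ γ) ⟨$⟩ 𝓕 R} {𝓕 (act γ ⟨$⟩ R)}
    (Ē.trans {act (ϑ γ) ⟨$⟩ 𝓕 R} {𝓕 (act γ ⟨$⟩ 𝓕⁻¹ (𝓕 R))} {𝓕 (act γ ⟨$⟩ R)} (conjugate γ (𝓕 R))
      (to-cong {act γ ⟨$⟩ 𝓕⁻¹ (𝓕 R)} {act γ ⟨$⟩ R}
        (MorphismOver.cong (act γ) {𝓕⁻¹ (𝓕 R)} {R} (strictlyInverseʳ R))))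

  -- Both rationality assumptions enter here: `π` is defined over `k`, so it commutes with
  -- Frobenius, and Frobenius fixes `Q`.
  𝓕-fibre : ∀ {R} → (π ⟨$⟩ R) ≈Y Q → (π ⟨$⟩ 𝓕 R) ≈Y Q
  𝓕-fibre {R} πR≈Q = Ȳ.trans {π ⟨$⟩ 𝓕 R} {FY.to (π ⟨$⟩ R)} {Q} (𝓕-commutes π R)
    (Ȳ.trans {FY.to (π ⟨$⟩ R)} {FY.to Q} {Q}
      (FY.to-cong {x = coord (π ⟨$⟩ R)} {y = coord Q} πR≈Q) (𝓕-rational Q Q-rational))

  invariant-fibre : ∀ γ {R} → (π ⟨$⟩ R) ≈Y Q → (π ⟨$⟩ (act γ ⟨$⟩ R)) ≈Y Q
  invariant-fibre γ {R} πR≈Q = Ȳ.trans {π ⟨$⟩ (act γ ⟨$⟩ R)} {π ⟨$⟩ R} {Q} (invariant γ R) πR≈Q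

  transitive : ∀ {R R′} → (π ⟨$⟩ R) ≈Y Q → (π ⟨$⟩ R′) ≈Y Q → ∃ λ γ → act γ ⟨$⟩ R ≋ R′
  transitive {R} {R′} πR≈Q πR′≈Q = orbit R R′
    (Ȳ.trans {π ⟨$⟩ R} {Q} {π ⟨$⟩ R′} πR≈Q (Ȳ.sym {π ⟨$⟩ R′} {Q} πR′≈Q))

  open TwistedFixedPoints ∣Λ∣≡n Λ-action isIsomorphism using (module Fibre)
  -- The orbit is the fibre over `Q` with base point `P`; equality of points is decided on
  -- projective coordinates.
  module T = Fibre (_∼?_ {Ē}) 𝓕 (λ {P} {R} → to-cong {P} {R}) 𝓕-act
    (λ R → (π ⟨$⟩ R) ≈Y Q) (λ γ {R} → invariant-fibre γ {R})
    (λ {R} → 𝓕-fibre {R}) (λ {R} {R′} → transitive {R} {R′}) {P} πP≈Q
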